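{- Let $n$ be an even positive integer. Then the stacked-book graph $G_{3,n}=S_3\Box P_n$ satisfies $$rn(G_{3,n})\leq \frac{3n^2}{2}+n.$$
   Context: $S_3$ denotes the star on $3$ vertices (a center vertex adjacent to two leaves, i.e. a path on 3 vertices viewed as a star) and $P_n$ the path on $n$ vertices. The stacked-book graph $G_{3,n}=S_3 \Box P_n$ is their Cartesian product. For a simple connected graph $G$ with distance $d$ and diameter $\mathrm{diam}(G)$, a radio labeling is a function $f:V(G)\to \mathbb{Z}_{\ge 0}$ such that $|f(u)-f(v)|\geq \mathrm{diam}(G)+1-d(u,v)$ for all distinct $u,v\in V(G)$. The span of $f$ is $\max_{v} f(v)-\min_{v} f(v)$. The radio number $rn(G)$ is the minimum span over all radio labelings of $G$. -}

module Defs where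

open import Data.Nat using (ℕ; zero; suc; _+_; _∸_; _≤_; ∣_-_∣)
open import Data.Fin using (Fin; toℕ)
open import Data.Product using (_×_; _,_; Σ; ∃)
open import Data.Sum using (_⊎_)
open import Relation.Binary.PropositionalEquality using (_≡_; _≢_)
open import Relation.Nullary using (¬_)

record Graph (V : Set) : Set₁ where
  field
    Adj : V → V → Set

open Graph public

data Walk {V : Set} (G : Graph V) : V → V → ℕ → Set where
  here : ∀ {u} → Walk G u u zero
  step : ∀ {u v w k} → Adj G u v → Walk G v w k → Walk G u w (suc k)

IsDist : {V : Set} → Graph V → V → V → ℕ → Set
IsDist G u v d = Walk G u v d × (∀ k → Walk G u v k → d ≤ k)

IsDiam : {V : Set} → Graph V → ℕ → Set
IsDiam G D = (∀ u v d → IsDist G u v d → d ≤ D)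
           × Σ _ λ u → Σ _ λ v → IsDist G u v D

IsRadioLabeling : {V : Set} → (G : Graph V) → ℕ → (V → ℕ) → Set
IsRadioLabeling G D f =
  ∀ u v d → u ≢ v → IsDist G u v d → D + 1 ∸ d ≤ ∣ f u - f v ∣

-- span f ≤ B, i.e. max f - min f ≤ B, i.e. f u - f v ≤ B for all u, v.
SpanAtMost : {V : Set} → (V → ℕ) → ℕ → Set
SpanAtMost f B = ∀ u v → f u ∸ f v ≤ B

RadioNumberAtMost : {V : Set} → Graph V → ℕ → Set
RadioNumberAtMost G B =
  ∀ D → IsDiam G D → ∃ λ f → IsRadioLabeling G D f × SpanAtMost f B

Star3 : Graph (Fin 3)
Adj Star3 a b = (toℕ a ≡ 0 × ¬ toℕ b ≡ 0) ⊎ (¬ toℕ a ≡ 0 × toℕ b ≡ 0)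

Path : (n : ℕ) → Graph (Fin n)
Adj (Path n) i j = ∣ toℕ i - toℕ j ∣ ≡ 1

_□_ : {V W : Set} → Graph V → Graph W → Graph (V × W)
Adj (G □ H) (a , i) (b , j) = (Adj G a b × i ≡ j) ⊎ (a ≡ b × Adj H i j)

StackedBook3 : (n : ℕ) → Graph (Fin 3 × Fin n)
StackedBook3 n = Star3 □ Path n

{-# OPTIONS --safe #-}

-- Let n = 2m. The vertices are listed in m blocks of six. Block j visits the
-- rows m + j and j alternately while the star coordinate runs cyclically
-- through leaf 2, leaf 1, centre; each label exceeds the previous one by exactly
-- n + 2 minus the distance of the two vertices. The gaps inside a block sum to
-- 5m + 3 and the gap to the next block is m, so the span is
-- m (5m + 3) + (m - 1) m = 6m² + 2m. All the inequalities required for vertices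
-- in the same or in different blocks are between linear forms in m with finitely
-- many possible coefficients.
module Submission where

open import Defs
open import Data.Nat using (ℕ; zero; suc; _+_; _*_; _/_; _≤_; _<_; _≤?_; ∣_-_∣; NonZero; z≤n; s≤s; s≤s⁻¹)
open import Data.Nat.Properties
open import Data.Nat.DivMod using (m*n/n≡m; /-congˡ)
open import Data.Nat.Divisibility using (_∣_; divides)
open import Data.Nat.Tactic.RingSolver using (solve-∀)
open import Data.Fin using (Fin; zero; suc; toℕ; combine; remQuot)
import Data.Fin.Properties as Fin
open import Data.Product using (_×_; _,_; proj₁; proj₂)
open import Data.Sum using (_⊎_; inj₁; inj₂)
open import Data.Unit using (tt)
open import Relation.Binary.Definitions using (tri<; tri≈; tri>)
open import Relation.Binary.PropositionalEquality
open import Relation.Nullary using (Dec; contradiction; _×-dec_; _⊎-dec_)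
open import Relation.Nullary.Decidable using (toWitness)

n+m≤o⇒m≤∣n-o∣ : ∀ m n o → n + m ≤ o → m ≤ ∣ n - o ∣
n+m≤o⇒m≤∣n-o∣ m n o n+m≤o =
  +-cancelˡ-≤ n m ∣ n - o ∣ (≤-trans n+m≤o (m≤n+∣n-m∣ o n))

-- Walks and distances

infixr 5 _++ʷ_

_++ʷ_ : ∀ {V} {G : Graph V} {u v w k l} → Walk G u v k → Walk G v w l → Walk G u w (k + l)
here     ++ʷ q = q
step e p ++ʷ q = step e (p ++ʷ q)

mapʷ : ∀ {V W} {G : Graph V} {H : Graph W} {u v k} (φ : V → W) →
       (∀ {a b} → Adj G a b → Adj H (φ a) (φ b)) →
       Walk G u v k → Walk H (φ u) (φ v) k
mapʷ φ hom here       = here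
mapʷ φ hom (step e p) = step (hom e) (mapʷ φ hom p)

□-walk : ∀ {V W} {G : Graph V} {H : Graph W} {a b i j k l} →
         Walk G a b k → Walk H i j l → Walk (G □ H) (a , i) (b , j) (k + l)
□-walk {b = b} {i = i} p q =
  mapʷ (_, i) (λ e → inj₁ (e , refl)) p ++ʷ mapʷ (b ,_) (λ e → inj₂ (refl , e)) q

star-dist : Fin 3 → Fin 3 → ℕ
star-dist zero          zero          = 0
star-dist zero          (suc _)       = 1
star-dist (suc _)       zero          = 1
star-dist (suc zero)    (suc zero)    = 0
star-dist (suc zero)    (suc (suc _)) = 2
star-dist (suc (suc _)) (suc zero)    = 2
star-dist (suc (suc _)) (suc (suc _)) = 0

star-dist-sym : ∀ a b → star-dist a b ≡ star-dist b a
star-dist-sym = toWitness {a? = Fin.all? λ a → Fin.all? λ b → _ ≟ _} tt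

star-dist≤2 : ∀ a b → star-dist a b ≤ 2
star-dist≤2 = toWitness {a? = Fin.all? λ a → Fin.all? λ b → _ ≤? _} tt

star-dist-triangle : ∀ a b c → star-dist a c ≤ star-dist a b + star-dist b c
star-dist-triangle =
  toWitness {a? = Fin.all? λ a → Fin.all? λ b → Fin.all? λ c → _ ≤? _} tt

star-dist-refl : ∀ a → star-dist a a ≡ 0
star-dist-refl = toWitness {a? = Fin.all? λ a → _ ≟ _} tt

star-dist-adj : ∀ a b → Adj Star3 a b → star-dist a b ≡ 1
star-dist-adj zero    zero    (inj₁ (_ , b≢0)) = contradiction refl b≢0
star-dist-adj zero    zero    (inj₂ (a≢0 , _)) = contradiction refl a≢0
star-dist-adj zero    (suc _) _                = refl
star-dist-adj (suc _) zero    _                = refl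
star-dist-adj (suc _) (suc _) (inj₁ (() , _))
star-dist-adj (suc _) (suc _) (inj₂ (_ , ()))

star-walk : ∀ a b → Walk Star3 a b (star-dist a b)
star-walk zero          zero          = here
star-walk zero          (suc _)       = step (inj₁ (refl , λ ())) here
star-walk (suc _)       zero          = step (inj₂ ((λ ()) , refl)) here
star-walk (suc zero)    (suc zero)    = here
star-walk (suc zero)    (suc (suc _)) =
  step {v = zero} (inj₂ ((λ ()) , refl)) (step (inj₁ (refl , λ ())) here)
star-walk (suc (suc _)) (suc zero)    =
  step {v = zero} (inj₂ ((λ ()) , refl)) (step (inj₁ (refl , λ ())) here)
star-walk (suc (suc zero)) (suc (suc zero)) = here

path-walk : ∀ {n} (i j : Fin n) → Walk (Path n) i j ∣ toℕ i - toℕ j ∣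
path-walk zero zero = here
path-walk {suc (suc n)} zero (suc j) =
  step refl (mapʷ suc (λ e → e) (path-walk zero j))
path-walk {suc (suc n)} (suc i) zero =
  subst (Walk _ _ _) (trans (+-comm _ 1) (cong suc (∣-∣-identityʳ (toℕ i))))
    (mapʷ suc (λ e → e) (path-walk i zero) ++ʷ step refl here)
path-walk (suc i) (suc j) = mapʷ suc (λ e → e) (path-walk i j)

book-dist : ∀ {n} → Fin 3 × Fin n → Fin 3 × Fin n → ℕ
book-dist (a , i) (b , j) = star-dist a b + ∣ toℕ i - toℕ j ∣

book-walk : ∀ {n} (u v : Fin 3 × Fin n) → Walk (StackedBook3 n) u v (book-dist u v)
book-walk (a , i) (b , j) = □-walk (star-walk a b) (path-walk i j)

-- An edge changes only one coordinate, so the triangle inequality in that coordinate loses at most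
-- 1. Induction along a walk then bounds its length below by `book-dist`.
book-dist-step : ∀ {n} (u v w : Fin 3 × Fin n) → Adj (StackedBook3 n) u v →
                 book-dist u w ≤ suc (book-dist v w)
book-dist-step (a , i) (b , .i) (c , l) (inj₁ (e , refl)) =
  +-monoˡ-≤ ∣ toℕ i - toℕ l ∣
    (subst (λ d → star-dist a c ≤ d + star-dist b c) (star-dist-adj a b e)
      (star-dist-triangle a b c))
book-dist-step (a , i) (.a , j) (c , l) (inj₂ (refl , e)) =
  ≤-trans
    (+-monoʳ-≤ (star-dist a c)
      (subst (λ d → ∣ toℕ i - toℕ l ∣ ≤ d + ∣ toℕ j - toℕ l ∣) e
        (∣-∣-triangle (toℕ i) (toℕ j) (toℕ l))))
    (≤-reflexive (+-suc (star-dist a c) ∣ toℕ j - toℕ l ∣))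

book-dist≤length : ∀ {n k} {u v : Fin 3 × Fin n} → Walk (StackedBook3 n) u v k → book-dist u v ≤ k
book-dist≤length {u = a , i} here =
  ≤-reflexive (cong₂ _+_ (star-dist-refl a) (∣n-n∣≡0 (toℕ i)))
book-dist≤length (step {u} {v} {w} e p) =
  ≤-trans (book-dist-step u v w e) (s≤s (book-dist≤length p))

book-dist≤1+n : ∀ {n} (u v : Fin 3 × Fin n) → book-dist u v ≤ suc n
book-dist≤1+n (a , i) (b , j) =
  ≤-trans (+-monoˡ-≤ _ (star-dist≤2 a b)) (s≤s (≤-<-trans (∣m-n∣≤m⊔n (toℕ i) (toℕ j))
    (⊔-lub (Fin.toℕ<n i) (Fin.toℕ<n j))))

-- The radio condition becomes stricter as `D` grows, so a labeling that meets it for `suc n` meets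
-- it for the actual diameter.
book-diam≤1+n : ∀ {n D} → IsDiam (StackedBook3 n) D → D ≤ suc n
book-diam≤1+n (_ , u , v , _ , shortest) =
  ≤-trans (shortest _ (book-walk u v)) (book-dist≤1+n u v)

-- Linear forms

-- (p , q) stands for the function m ↦ p m + q.
Linear : Set
Linear = ℕ × ℕ

⟦_⟧ : Linear → ℕ → ℕ
⟦ p , q ⟧ m = p * m + q

infixl 6 _⊕_
_⊕_ : Linear → Linear → Linear
(p , q) ⊕ (r , s) = p + r , q + s

⟦⊕⟧ : ∀ x y m → ⟦ x ⊕ y ⟧ m ≡ ⟦ x ⟧ m + ⟦ y ⟧ m
⟦⊕⟧ (p , q) (r , s) m = lemma p q r s m
  where
  lemma : ∀ p q r s m → (p + r) * m + (q + s) ≡ (p * m + q) + (r * m + s)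
  lemma = solve-∀

-- Domination for all m ≥ 1: compare slopes and the values at m = 1.
infix 4 _⊑_ _⊑?_
_⊑_ : Linear → Linear → Set
(p , q) ⊑ (r , s) = p ≤ r × p + q ≤ r + s

_⊑?_ : ∀ x y → Dec (x ⊑ y)
(p , q) ⊑? (r , s) = p ≤? r ×-dec p + q ≤? r + s

-- At `suc m` the form is `p * m + (p + q)`, whose coefficients are the slope and the value at 1.
⟦⟧-mono : ∀ x y m .{{_ : NonZero m}} → x ⊑ y → ⟦ x ⟧ m ≤ ⟦ y ⟧ m
⟦⟧-mono (p , q) (r , s) (suc m) (p≤r , p+q≤r+s) = begin
  p * suc m + q    ≡⟨ lemma p q m ⟩
  p * m + (p + q)  ≤⟨ +-mono-≤ (*-monoˡ-≤ m p≤r) p+q≤r+s ⟩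
  r * m + (r + s)  ≡⟨ lemma r s m ⟨
  r * suc m + s    ∎
  where
  open ≤-Reasoning
  lemma : ∀ p q m → p * suc m + q ≡ p * m + (p + q)
  lemma = solve-∀

-- The labeling

-- In visiting order: 0, m, 2m + 1, 3m + 2, 4m + 2, 5m + 3. Consecutive rows are m apart, so the gap
-- is m between the two leaves and m + 1 between a leaf and the centre.
offset : Fin 3 → Fin 2 → Linear
offset zero             zero       = 5 , 3
offset zero             (suc zero) = 2 , 1
offset (suc zero)       zero       = 1 , 0
offset (suc zero)       (suc zero) = 4 , 2
offset (suc (suc zero)) zero       = 3 , 2
offset (suc (suc zero)) (suc zero) = 0 , 0

-- The centre in row j and leaf 2 in row m + j + 1 are at distance m + 2; their gap m is added to
-- the last offset 5m + 3.
period : Linear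
period = 6 , 3

label : ℕ → Fin 3 → Fin 2 → ℕ → ℕ
label m a h j = ⟦ offset a h ⟧ m + j * ⟦ period ⟧ m

row : ℕ → Fin 2 → ℕ → ℕ
row m h j = m * toℕ h + j

row-gap₌ : Fin 2 → Fin 2 → Linear
row-gap₌ zero       zero       = 0 , 0
row-gap₌ zero       (suc zero) = 1 , 0
row-gap₌ (suc zero) zero       = 1 , 0
row-gap₌ (suc zero) (suc zero) = 0 , 0

row-gap₌-≤ : ∀ m h k j → ⟦ row-gap₌ h k ⟧ m ≤ ∣ row m h j - row m k j ∣
row-gap₌-≤ m zero       zero       j = z≤n
row-gap₌-≤ m (suc zero) (suc zero) j = z≤n
row-gap₌-≤ m zero       (suc zero) j = n+m≤o⇒m≤∣n-o∣ _ (row m zero j) _ (≤-reflexive (lemma m j))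
  where
  lemma : ∀ m j → m * 0 + j + (1 * m + 0) ≡ m * 1 + j
  lemma = solve-∀
row-gap₌-≤ m (suc zero) zero       j =
  subst (_ ≤_) (∣-∣-comm (row m zero j) _) (row-gap₌-≤ m zero (suc zero) j)

-- Lower bounds valid for every later block. From row m + j to row l, the bound `j < l` alone allows
-- equality, hence the value 0.
row-gap₊ : Fin 2 → Fin 2 → Linear
row-gap₊ zero       zero       = 0 , 1
row-gap₊ zero       (suc zero) = 1 , 1
row-gap₊ (suc zero) zero       = 0 , 0
row-gap₊ (suc zero) (suc zero) = 0 , 1

row-gap₊-≤ : ∀ m h k {j l} → j < l → ⟦ row-gap₊ h k ⟧ m ≤ ∣ row m h j - row m k l ∣
row-gap₊-≤ m zero zero {j} {l} j<l = n+m≤o⇒m≤∣n-o∣ 1 (row m zero j) _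
  (≤-trans (≤-reflexive (lemma m j)) (+-monoʳ-≤ (m * 0) j<l))
  where
  lemma : ∀ m j → m * 0 + j + 1 ≡ m * 0 + suc j
  lemma = solve-∀
row-gap₊-≤ m zero (suc zero) {j} {l} j<l = n+m≤o⇒m≤∣n-o∣ _ (row m zero j) _
  (≤-trans (≤-reflexive (lemma m j)) (+-monoʳ-≤ (m * 1) j<l))
  where
  lemma : ∀ m j → m * 0 + j + (1 * m + 1) ≡ m * 1 + suc j
  lemma = solve-∀
row-gap₊-≤ m (suc zero) zero j<l = z≤n
row-gap₊-≤ m (suc zero) (suc zero) {j} {l} j<l = n+m≤o⇒m≤∣n-o∣ 1 (row m (suc zero) j) _
  (≤-trans (≤-reflexive (lemma m j)) (+-monoʳ-≤ (m * 1) j<l))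
  where
  lemma : ∀ m j → m * 1 + j + 1 ≡ m * 1 + suc j
  lemma = solve-∀

-- The linear form of n + 2, which is diam + 1.
target : Linear
target = 2 , 2

-- The two alternatives are the two possible orders of the labels. With linear forms in place of
-- numbers, one finite check covers all m ≥ 1.
same-block : ∀ a h b k → (a ≡ b × h ≡ k)
  ⊎ offset a h ⊕ target ⊑ offset b k ⊕ ((0 , star-dist a b) ⊕ row-gap₌ h k)
  ⊎ offset b k ⊕ target ⊑ offset a h ⊕ ((0 , star-dist a b) ⊕ row-gap₌ h k)
same-block = toWitness
  {a? = Fin.all? λ a → Fin.all? λ h → Fin.all? λ b → Fin.all? λ k →
    (a Fin.≟ b ×-dec h Fin.≟ k) ⊎-dec (_ ⊑? _) ⊎-dec (_ ⊑? _)} tt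

-- One period is enough for all later blocks: further blocks only raise the second label. Equality
-- occurs from the centre in the lower half to leaf 2 in the upper half.
later-block : ∀ a h b k →
  offset a h ⊕ target ⊑ (offset b k ⊕ period) ⊕ ((0 , star-dist a b) ⊕ row-gap₊ h k)
later-block = toWitness
  {a? = Fin.all? λ a → Fin.all? λ h → Fin.all? λ b → Fin.all? λ k → _ ⊑? _} tt

-- From offsets to labels of pairs of vertices

separate : ∀ t x y g d e → x + t ≤ y + (g + d) → d ≤ e → t ≤ g + e + ∣ x - y ∣
separate t x y g d e x+t≤y+g+d d≤e = +-cancelˡ-≤ x t _ (begin
  x + t                      ≤⟨ x+t≤y+g+d ⟩
  -- `y ≤ x + ∣ x - y ∣` holds whichever of the two labels is larger.
  y + (g + d)                ≤⟨ +-mono-≤ (m≤n+∣n-m∣ y x) (+-monoʳ-≤ g d≤e) ⟩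
  x + ∣ x - y ∣ + (g + e)    ≡⟨ +-assoc x _ _ ⟩
  x + (∣ x - y ∣ + (g + e))  ≡⟨ cong (x +_) (+-comm _ (g + e)) ⟩
  x + (g + e + ∣ x - y ∣)    ∎)
  where open ≤-Reasoning

-- Here `z` is the block shift of the first label and `w` is the second label, bounded only from
-- below. This form serves equal blocks and later blocks alike.
separated-offsets : ∀ m .{{_ : NonZero m}} x y s r e →
  x ⊕ target ⊑ y ⊕ ((0 , s) ⊕ r) → ⟦ r ⟧ m ≤ e → ∀ {z w} →
  z + ⟦ y ⟧ m ≤ w →
  ⟦ target ⟧ m ≤ s + e + ∣ ⟦ x ⟧ m + z - w ∣
separated-offsets m x y s r e x⊑y r≤e {z} {w} z+y≤w =
  separate (⟦ target ⟧ m) (⟦ x ⟧ m + z) w s (⟦ r ⟧ m) e (begin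
    ⟦ x ⟧ m + z + ⟦ target ⟧ m           ≡⟨ lemma (⟦ x ⟧ m) z _ ⟩
    z + (⟦ x ⟧ m + ⟦ target ⟧ m)         ≡⟨ cong (z +_) (⟦⊕⟧ x target m) ⟨
    z + ⟦ x ⊕ target ⟧ m                 ≤⟨ +-monoʳ-≤ z (⟦⟧-mono (x ⊕ target) (y ⊕ ((0 , s) ⊕ r)) m x⊑y) ⟩
    z + ⟦ y ⊕ ((0 , s) ⊕ r) ⟧ m          ≡⟨ cong (z +_) (⟦⊕⟧ y ((0 , s) ⊕ r) m) ⟩
    z + (⟦ y ⟧ m + ⟦ (0 , s) ⊕ r ⟧ m)    ≡⟨ +-assoc z _ _ ⟨
    z + ⟦ y ⟧ m + ⟦ (0 , s) ⊕ r ⟧ m      ≤⟨ +-mono-≤ z+y≤w (≤-reflexive (⟦⊕⟧ (0 , s) r m)) ⟩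
    w + (s + ⟦ r ⟧ m)                    ∎) r≤e
  where
  open ≤-Reasoning
  lemma : ∀ x z t → x + z + t ≡ z + (x + t)
  lemma = solve-∀

-- The radio condition with the distance moved to the right, which avoids truncated subtraction.
Separated : ℕ → Fin 3 → Fin 2 → ℕ → Fin 3 → Fin 2 → ℕ → Set
Separated m a h j b k l =
  ⟦ target ⟧ m ≤ star-dist a b + ∣ row m h j - row m k l ∣ + ∣ label m a h j - label m b k l ∣

separated-sym : ∀ m a h j b k l → Separated m a h j b k l → Separated m b k l a h j
separated-sym m a h j b k l = subst (⟦ target ⟧ m ≤_)
  (cong₂ _+_ (cong₂ _+_ (star-dist-sym a b) (∣-∣-comm (row m h j) _)) (∣-∣-comm (label m a h j) _))

separated-same : ∀ m .{{_ : NonZero m}} a h b k j → (a ≡ b × h ≡ k) ⊎ Separated m a h j b k j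
separated-same m a h b k j with same-block a h b k
... | inj₁ eq = inj₁ eq
... | inj₂ (inj₁ a⊑b) = inj₂
  (separated-offsets m (offset a h) (offset b k) _ (row-gap₌ h k) _ a⊑b
    (row-gap₌-≤ m h k j) (≤-reflexive (+-comm (j * ⟦ period ⟧ m) _)))
... | inj₂ (inj₂ b⊑a) = inj₂ (subst (λ e → ⟦ target ⟧ m ≤ star-dist a b + ∣ row m h j - row m k j ∣ + e)
  (∣-∣-comm (label m b k j) _)
  (separated-offsets m (offset b k) (offset a h) _ (row-gap₌ h k) _ b⊑a
    (row-gap₌-≤ m h k j) (≤-reflexive (+-comm (j * ⟦ period ⟧ m) _))))

separated-later : ∀ m .{{_ : NonZero m}} a h b k {j l} → j < l → Separated m a h j b k l
separated-later m a h b k {j} {l} j<l =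
  separated-offsets m (offset a h) (offset b k ⊕ period) _ (row-gap₊ h k) _
    (later-block a h b k) (row-gap₊-≤ m h k j<l) (begin
      j * P + ⟦ offset b k ⊕ period ⟧ m  ≡⟨ cong (j * P +_) (⟦⊕⟧ (offset b k) period m) ⟩
      j * P + (⟦ offset b k ⟧ m + P)     ≡⟨ lemma j P (⟦ offset b k ⟧ m) ⟩
      ⟦ offset b k ⟧ m + suc j * P       ≤⟨ +-monoʳ-≤ (⟦ offset b k ⟧ m) (*-monoˡ-≤ P j<l) ⟩
      ⟦ offset b k ⟧ m + l * P           ∎)
  where
  open ≤-Reasoning
  P = ⟦ period ⟧ m
  lemma : ∀ j P x → j * P + (x + P) ≡ x + (P + j * P)
  lemma = solve-∀

separated : ∀ m .{{_ : NonZero m}} a h j b k l → (a ≡ b × h ≡ k × j ≡ l) ⊎ Separated m a h j b k l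
separated m a h j b k l with <-cmp j l
... | tri< j<l _ _ = inj₂ (separated-later m a h b k j<l)
... | tri> _ _ l<j = inj₂ (separated-sym m b k l a h j (separated-later m b k a h l<j))
... | tri≈ _ refl _ with separated-same m a h b k j
...   | inj₁ (a≡b , h≡k) = inj₁ (a≡b , h≡k , refl)
...   | inj₂ sep         = inj₂ sep

offset≤ : ∀ a h → offset a h ⊑ (5 , 3)
offset≤ = toWitness {a? = Fin.all? λ a → Fin.all? λ h → _ ⊑? _} tt

-- The extreme case is the centre in the lower half of the last block, where `j` is `p`, that is m -
-- 1.
label≤ : ∀ m .{{_ : NonZero m}} a h {j} → j < m → label m a h j ≤ 6 * m * m + 2 * m
label≤ m@(suc p) a h {j} j<m = begin
  ⟦ offset a h ⟧ m + j * ⟦ period ⟧ m  ≤⟨ +-mono-≤ (⟦⟧-mono (offset a h) (5 , 3) m (offset≤ a h))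
                                           (*-monoˡ-≤ (⟦ period ⟧ m) (s≤s⁻¹ j<m)) ⟩
  ⟦ 5 , 3 ⟧ m + p * ⟦ period ⟧ m       ≡⟨ lemma p ⟩
  6 * m * m + 2 * m                    ∎
  where
  open ≤-Reasoning
  lemma : ∀ p → 5 * suc p + 3 + p * (6 * suc p + 3) ≡ 6 * suc p * suc p + 2 * suc p
  lemma = solve-∀

-- The radio number

-- Quotient and remainder of a row by m, the inverse of `row`; the factor order in `2 * m` is the
-- one that `remQuot` splits.
half : ∀ m → Fin (2 * m) → Fin 2
half m i = proj₁ (remQuot {2} m i)

index : ∀ m → Fin (2 * m) → Fin m
index m i = proj₂ (remQuot {2} m i)

toℕ≡row : ∀ m i → toℕ i ≡ row m (half m i) (toℕ (index m i))
toℕ≡row m i = trans (cong toℕ (sym (Fin.combine-remQuot {2} m i))) (Fin.toℕ-combine (half m i) (index m i))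

half-index-injective : ∀ m {i j} → half m i ≡ half m j → index m i ≡ index m j → i ≡ j
half-index-injective m {i} {j} h≡ x≡ = begin
  i                                ≡⟨ Fin.combine-remQuot {2} m i ⟨
  combine (half m i) (index m i)   ≡⟨ cong₂ combine h≡ x≡ ⟩
  combine (half m j) (index m j)   ≡⟨ Fin.combine-remQuot {2} m j ⟩
  j                                ∎
  where open ≡-Reasoning

labeling : ∀ m → Fin 3 × Fin (2 * m) → ℕ
labeling m (a , i) = label m a (half m i) (toℕ (index m i))

labeling-separated : ∀ m .{{_ : NonZero m}} u v → u ≢ v →
  2 * m + 2 ≤ book-dist u v + ∣ labeling m u - labeling m v ∣
labeling-separated m (a , i) (b , j) u≢v
  with separated m a (half m i) (toℕ (index m i)) b (half m j) (toℕ (index m j))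
... | inj₁ (refl , h≡ , x≡) =
  contradiction (cong (a ,_) (half-index-injective m h≡ (Fin.toℕ-injective x≡))) u≢v
... | inj₂ sep = subst₂
  (λ x y → 2 * m + 2 ≤ star-dist a b + ∣ x - y ∣ + ∣ labeling m (a , i) - labeling m (b , j) ∣)
  (sym (toℕ≡row m i)) (sym (toℕ≡row m j)) sep

labeling-radio : ∀ m .{{_ : NonZero m}} {D} → D ≤ suc (2 * m) →
  IsRadioLabeling (StackedBook3 (2 * m)) D (labeling m)
labeling-radio m {D} D≤ u v d u≢v (walk , _) = m≤n+o⇒m∸n≤o (D + 1) d (begin
  D + 1                                            ≤⟨ +-monoˡ-≤ 1 D≤ ⟩
  suc (2 * m) + 1                                  ≡⟨ +-suc (2 * m) 1 ⟨
  2 * m + 2                                        ≤⟨ labeling-separated m u v u≢v ⟩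
  -- A walk of length `d` has at least `book-dist u v` steps, which passes from the explicit formula
  -- to the given distance.
  book-dist u v + ∣ labeling m u - labeling m v ∣  ≤⟨ +-monoˡ-≤ _ (book-dist≤length walk) ⟩
  d + ∣ labeling m u - labeling m v ∣              ∎)
  where open ≤-Reasoning

-- For n = 2m the number 3n² is twice 6m², so the division by 2 is exact.
bound : ∀ m → 6 * m * m + 2 * m ≡ (3 * (2 * m) * (2 * m)) / 2 + 2 * m
bound m = cong (_+ 2 * m) (sym (trans (/-congˡ {o = 2} (lemma m)) (m*n/n≡m (6 * m * m) 2)))
  where
  lemma : ∀ m → 3 * (2 * m) * (2 * m) ≡ 6 * m * m * 2
  lemma = solve-∀

radio-number-even : ∀ m .{{_ : NonZero m}} →
  RadioNumberAtMost (StackedBook3 (2 * m)) ((3 * (2 * m) * (2 * m)) / 2 + 2 * m)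
radio-number-even m D diam =
  labeling m , labeling-radio m (book-diam≤1+n diam) , λ u@(a , i) v →
    -- Labels are nonnegative, so the largest label bounds the span.
    ≤-trans (m∸n≤m (labeling m u) (labeling m v))
      (≤-trans (label≤ m a (half m i) (Fin.toℕ<n (index m i))) (≤-reflexive (bound m)))

theorem3p13 : (n : ℕ) → 0 < n → 2 ∣ n →
    RadioNumberAtMost (StackedBook3 n) ((3 * n * n) / 2 + n)
theorem3p13 n 0<n (divides (suc p) n≡m*2) =
  subst (λ n → RadioNumberAtMost (StackedBook3 n) ((3 * n * n) / 2 + n))
    (trans (*-comm 2 (suc p)) (sym n≡m*2)) (radio-number-even (suc p))
theorem3p13 n 0<n (divides zero refl) = contradiction 0<n (n≮n 0)
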